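{- For all $n\ge1$, $$\mathbf{Sf}_{n,1}(p,q)=q^{n-1}\qquad\text{and}\qquad \mathbf{cf}_{n,1}(p,q)=\prod_{i=1}^{n-1}F_i(p,q).$$ For all $n\ge2$, $$\mathbf{Sf}_{n,2}(p,q)=q^{n-2}[n-1]_q\qquad\text{and}\qquad \mathbf{cf}_{n,n-1}(p,q)=\mathbf{Sf}_{n,n-1}(p,q)=\sum_{i=1}^{n-1}F_i(p,q).$$
   Context: $F_1(p,q)=q$, $F_2(p,q)=q^2$ and $F_m(p,q)=qF_{m-1}(p,q)+pF_{m-2}(p,q)$ for $m\ge3$. Let $(x)_{\downarrow_{F,p,q,0}}=(x)_{\uparrow_{F,p,q,0}}=1$ and for $k\ge1$, $(x)_{\downarrow_{F,p,q,k}}=x(x-F_1(p,q))\cdots(x-F_{k-1}(p,q))$ and $(x)_{\uparrow_{F,p,q,k}}=x(x+F_1(p,q))\cdots(x+F_{k-1}(p,q))$. Define $\mathbf{Sf}_{n,k}(p,q)$ and $\mathbf{cf}_{n,k}(p,q)$ for $0\le k\le n$ by $x^n=\sum_{k=0}^n\mathbf{Sf}_{n,k}(p,q)(x)_{\downarrow_{F,p,q,k}}$ and $(x)_{\uparrow_{F,p,q,n}}=\sum_{k=0}^n\mathbf{cf}_{n,k}(p,q)x^k$. For $m\ge1$, $[m]_q=1+q+\cdots+q^{m-1}$. -}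

module Defs where

open import Algebra.Bundles using (CommutativeRing; AbelianGroup)
open import Data.Fin.Base using (zero; suc; toℕ; inject₁; fromℕ)
open import Data.Fin.Properties using (toℕ-inject₁; toℕ-fromℕ)
open import Data.List.Base using (List; []; _∷_; map)
open import Data.Nat.Base using (ℕ; zero; suc; _<_; s≤s)
open import Data.Nat.Properties using (≤-refl; m<n⇒m<1+n)
open import Data.Product.Base using (∃; _,_)
open import Relation.Binary.PropositionalEquality.Core as ≡ using (_≡_)

import Algebra.Properties.CommutativeMonoid.Sum as MonoidSum
import Algebra.Properties.CommutativeSemigroup as CommutativeSemigroupProperties
import Algebra.Properties.Ring as RingProperties
import Algebra.Properties.Semiring.Exp as Exp
import Algebra.Properties.Semiring.Sum as Sum
import Relation.Binary.Reasoning.Setoid as SetoidReasoning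

-- The polynomial ring R[x].  A polynomial is its list of coefficients,
-- constant term first; trailing zeros are allowed, so equality of
-- polynomials is equality of all coefficients.

module Polynomial {c ℓ} (R : CommutativeRing c ℓ) where

  open CommutativeRing R

  infix  4 _≋_
  infixl 6 _⊕_
  infixl 7 _⊗_
  infix  8 ⊖_

  Poly : Set c
  Poly = List Carrier

  coeff : Poly → ℕ → Carrier
  coeff []      _       = 0#
  coeff (a ∷ f) zero    = a
  coeff (a ∷ f) (suc i) = coeff f i

  record _≋_ (f g : Poly) : Set ℓ where
    constructor mk
    field
      coeff-≈ : ∀ i → coeff f i ≈ coeff g i

  open _≋_ public

  _⊕_ : Poly → Poly → Poly
  []      ⊕ g       = g
  (a ∷ f) ⊕ []      = a ∷ f
  (a ∷ f) ⊕ (b ∷ g) = (a + b) ∷ (f ⊕ g)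

  ⊖_ : Poly → Poly
  ⊖_ = map (-_)

  scale : Carrier → Poly → Poly
  scale a = map (a *_)

  -- (a + x f) g = a g + x (f g)
  _⊗_ : Poly → Poly → Poly
  []      ⊗ g = []
  (a ∷ f) ⊗ g = scale a g ⊕ (0# ∷ f ⊗ g)

  C : Carrier → Poly
  C a = a ∷ []

  X : Poly
  X = 0# ∷ 1# ∷ []

  private

    ≋-refl : ∀ {f} → f ≋ f
    ≋-refl = mk λ _ → refl

    ≋-sym : ∀ {f g} → f ≋ g → g ≋ f
    ≋-sym e = mk λ i → sym (coeff-≈ e i)

    ≋-trans : ∀ {f g h} → f ≋ g → g ≋ h → f ≋ h
    ≋-trans e e′ = mk λ i → trans (coeff-≈ e i) (coeff-≈ e′ i)

    ∷-cong : ∀ {a b f g} → a ≈ b → f ≋ g → (a ∷ f) ≋ (b ∷ g)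
    ∷-cong a≈b f≋g = mk λ { zero → a≈b ; (suc i) → coeff-≈ f≋g i }

    coeff-⊕ : ∀ f g i → coeff (f ⊕ g) i ≈ coeff f i + coeff g i
    coeff-⊕ []      g       i       = sym (+-identityˡ _)
    coeff-⊕ (a ∷ f) []      i       = sym (+-identityʳ _)
    coeff-⊕ (a ∷ f) (b ∷ g) zero    = refl
    coeff-⊕ (a ∷ f) (b ∷ g) (suc i) = coeff-⊕ f g i

    coeff-⊖ : ∀ f i → coeff (⊖ f) i ≈ - coeff f i
    coeff-⊖ []      i       = sym (RingProperties.-0#≈0# ring)
    coeff-⊖ (a ∷ f) zero    = refl
    coeff-⊖ (a ∷ f) (suc i) = coeff-⊖ f i

    coeff-scale : ∀ a f i → coeff (scale a f) i ≈ a * coeff f i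
    coeff-scale a []      i       = sym (zeroʳ a)
    coeff-scale a (b ∷ f) zero    = refl
    coeff-scale a (b ∷ f) (suc i) = coeff-scale a f i

    ⊕-cong : ∀ {f f′ g g′} → f ≋ f′ → g ≋ g′ → (f ⊕ g) ≋ (f′ ⊕ g′)
    ⊕-cong {f} {f′} {g} {g′} e e′ = mk λ i →
      trans (coeff-⊕ f g i)
        (trans (+-cong (coeff-≈ e i) (coeff-≈ e′ i)) (sym (coeff-⊕ f′ g′ i)))

    ⊖-cong : ∀ {f g} → f ≋ g → (⊖ f) ≋ (⊖ g)
    ⊖-cong {f} {g} e = mk λ i →
      trans (coeff-⊖ f i) (trans (-‿cong (coeff-≈ e i)) (sym (coeff-⊖ g i)))

    ⊕-assoc : ∀ f g h → (f ⊕ g) ⊕ h ≋ f ⊕ (g ⊕ h)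
    ⊕-assoc f g h = mk λ i → begin
      coeff (f ⊕ g ⊕ h) i                   ≈⟨ coeff-⊕ (f ⊕ g) h i ⟩
      coeff (f ⊕ g) i + coeff h i           ≈⟨ +-congʳ (coeff-⊕ f g i) ⟩
      coeff f i + coeff g i + coeff h i     ≈⟨ +-assoc _ _ _ ⟩
      coeff f i + (coeff g i + coeff h i)   ≈⟨ +-congˡ (coeff-⊕ g h i) ⟨
      coeff f i + coeff (g ⊕ h) i           ≈⟨ coeff-⊕ f (g ⊕ h) i ⟨
      coeff (f ⊕ (g ⊕ h)) i                 ∎
      where open SetoidReasoning setoid

    ⊕-comm : ∀ f g → f ⊕ g ≋ g ⊕ f
    ⊕-comm f g = mk λ i →
      trans (coeff-⊕ f g i) (trans (+-comm _ _) (sym (coeff-⊕ g f i)))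

    ⊕-identityʳ : ∀ f → f ⊕ [] ≋ f
    ⊕-identityʳ f = mk λ i → trans (coeff-⊕ f [] i) (+-identityʳ _)

    ⊖-inverseˡ : ∀ f → (⊖ f) ⊕ f ≋ []
    ⊖-inverseˡ f = mk λ i → trans (coeff-⊕ (⊖ f) f i)
      (trans (+-congʳ (coeff-⊖ f i)) (-‿inverseˡ _))

    ⊕-abelianGroup : AbelianGroup c ℓ
    ⊕-abelianGroup = record
      { Carrier = Poly
      ; _≈_ = _≋_
      ; _∙_ = _⊕_
      ; ε = []
      ; _⁻¹ = ⊖_
      ; isAbelianGroup = record
        { isGroup = record
          { isMonoid = record
            { isSemigroup = record
              { isMagma = record
                { isEquivalence = record
                  { refl = ≋-refl ; sym = ≋-sym ; trans = ≋-trans }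
                ; ∙-cong = ⊕-cong
                }
              ; assoc = ⊕-assoc
              }
            ; identity = (λ _ → ≋-refl) , ⊕-identityʳ
            }
          ; inverse = ⊖-inverseˡ , λ f → ≋-trans (⊕-comm f (⊖ f)) (⊖-inverseˡ f)
          ; ⁻¹-cong = ⊖-cong
          }
        ; comm = ⊕-comm
        }
      }

    open AbelianGroup ⊕-abelianGroup using ()
      renaming (setoid to ≋-setoid; commutativeSemigroup to ⊕-commutativeSemigroup)
    open CommutativeSemigroupProperties ⊕-commutativeSemigroup
      using (interchange; x∙yz≈y∙xz)

    module ≋-Reasoning = SetoidReasoning ≋-setoid

    scale-cong : ∀ {a b f g} → a ≈ b → f ≋ g → scale a f ≋ scale b g
    scale-cong {a} {b} {f} {g} e e′ = mk λ i → trans (coeff-scale a f i)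
      (trans (*-cong e (coeff-≈ e′ i)) (sym (coeff-scale b g i)))

    scale-zero : ∀ {a} f → a ≈ 0# → scale a f ≋ []
    scale-zero {a} f e = mk λ i →
      trans (coeff-scale a f i) (trans (*-congʳ e) (zeroˡ _))

    scale-one : ∀ f → scale 1# f ≋ f
    scale-one f = mk λ i → trans (coeff-scale 1# f i) (*-identityˡ _)

    scale-+ : ∀ a b f → scale (a + b) f ≋ scale a f ⊕ scale b f
    scale-+ a b f = mk λ i → begin
      coeff (scale (a + b) f) i                     ≈⟨ coeff-scale (a + b) f i ⟩
      (a + b) * coeff f i                           ≈⟨ distribʳ _ a b ⟩
      a * coeff f i + b * coeff f i                 ≈⟨ +-cong (coeff-scale a f i) (coeff-scale b f i) ⟨
      coeff (scale a f) i + coeff (scale b f) i     ≈⟨ coeff-⊕ (scale a f) (scale b f) i ⟨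
      coeff (scale a f ⊕ scale b f) i               ∎
      where open SetoidReasoning setoid

    scale-⊕ : ∀ a f g → scale a (f ⊕ g) ≋ scale a f ⊕ scale a g
    scale-⊕ a f g = mk λ i → begin
      coeff (scale a (f ⊕ g)) i                     ≈⟨ coeff-scale a (f ⊕ g) i ⟩
      a * coeff (f ⊕ g) i                           ≈⟨ *-congˡ (coeff-⊕ f g i) ⟩
      a * (coeff f i + coeff g i)                   ≈⟨ distribˡ a _ _ ⟩
      a * coeff f i + a * coeff g i                 ≈⟨ +-cong (coeff-scale a f i) (coeff-scale a g i) ⟨
      coeff (scale a f) i + coeff (scale a g) i     ≈⟨ coeff-⊕ (scale a f) (scale a g) i ⟨
      coeff (scale a f ⊕ scale a g) i               ∎
      where open SetoidReasoning setoid

    scale-* : ∀ a b f → scale (a * b) f ≋ scale a (scale b f)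
    scale-* a b f = mk λ i → begin
      coeff (scale (a * b) f) i       ≈⟨ coeff-scale (a * b) f i ⟩
      a * b * coeff f i               ≈⟨ *-assoc a b _ ⟩
      a * (b * coeff f i)             ≈⟨ *-congˡ (coeff-scale b f i) ⟨
      a * coeff (scale b f) i         ≈⟨ coeff-scale a (scale b f) i ⟨
      coeff (scale a (scale b f)) i   ∎
      where open SetoidReasoning setoid

    0∷[] : (0# ∷ []) ≋ []
    0∷[] = mk λ { zero → refl ; (suc i) → refl }

    0∷-⊕ : ∀ f g → (0# ∷ (f ⊕ g)) ≋ (0# ∷ f) ⊕ (0# ∷ g)
    0∷-⊕ f g = ∷-cong (sym (+-identityˡ 0#)) ≋-refl

    0∷-scale : ∀ a f → (0# ∷ scale a f) ≋ scale a (0# ∷ f)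
    0∷-scale a f = ∷-cong (sym (zeroʳ a)) ≋-refl

    ⊗-zeroˡ : ∀ f g → f ≋ [] → f ⊗ g ≋ []
    ⊗-zeroˡ []      g e = ≋-refl
    ⊗-zeroˡ (a ∷ f) g e = ⊕-cong (scale-zero g (coeff-≈ e 0))
      (≋-trans (∷-cong refl (⊗-zeroˡ f g (mk λ i → coeff-≈ e (suc i)))) 0∷[])

    ⊗-cong : ∀ {f f′ g g′} → f ≋ f′ → g ≋ g′ → f ⊗ g ≋ f′ ⊗ g′
    ⊗-cong {[]}    {f′} {g} {g′} e e′ = ≋-sym (⊗-zeroˡ f′ g′ (≋-sym e))
    ⊗-cong {a ∷ f} {[]} {g} {g′} e e′ = ⊗-zeroˡ (a ∷ f) g e
    ⊗-cong {a ∷ f} {b ∷ f′} e e′ = ⊕-cong (scale-cong (coeff-≈ e 0) e′)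
      (∷-cong refl (⊗-cong {f} {f′} (mk λ i → coeff-≈ e (suc i)) e′))

    ⊗-distribʳ : ∀ h f g → (f ⊕ g) ⊗ h ≋ f ⊗ h ⊕ g ⊗ h
    ⊗-distribʳ h []      g       = ≋-refl
    ⊗-distribʳ h (a ∷ f) []      = ≋-sym (⊕-identityʳ _)
    ⊗-distribʳ h (a ∷ f) (b ∷ g) = begin
      scale (a + b) h ⊕ (0# ∷ (f ⊕ g) ⊗ h)
        ≈⟨ ⊕-cong (scale-+ a b h) (≋-trans (∷-cong refl (⊗-distribʳ h f g)) (0∷-⊕ (f ⊗ h) (g ⊗ h))) ⟩
      (scale a h ⊕ scale b h) ⊕ ((0# ∷ f ⊗ h) ⊕ (0# ∷ g ⊗ h))
        ≈⟨ interchange (scale a h) (scale b h) (0# ∷ f ⊗ h) (0# ∷ g ⊗ h) ⟩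
      (a ∷ f) ⊗ h ⊕ (b ∷ g) ⊗ h ∎
      where open ≋-Reasoning

    ⊗-scale : ∀ a f g → scale a f ⊗ g ≋ scale a (f ⊗ g)
    ⊗-scale a []      g = ≋-refl
    ⊗-scale a (b ∷ f) g = begin
      scale (a * b) g ⊕ (0# ∷ scale a f ⊗ g)
        ≈⟨ ⊕-cong (scale-* a b g) (≋-trans (∷-cong refl (⊗-scale a f g)) (0∷-scale a _)) ⟩
      scale a (scale b g) ⊕ scale a (0# ∷ f ⊗ g)
        ≈⟨ scale-⊕ a (scale b g) (0# ∷ f ⊗ g) ⟨
      scale a ((b ∷ f) ⊗ g) ∎
      where open ≋-Reasoning

    0∷-⊗ : ∀ f g → (0# ∷ f) ⊗ g ≋ (0# ∷ f ⊗ g)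
    0∷-⊗ f g = ⊕-cong (scale-zero g refl) ≋-refl

    ⊗-assoc : ∀ f g h → (f ⊗ g) ⊗ h ≋ f ⊗ (g ⊗ h)
    ⊗-assoc []      g h = ≋-refl
    ⊗-assoc (a ∷ f) g h = begin
      (scale a g ⊕ (0# ∷ f ⊗ g)) ⊗ h
        ≈⟨ ⊗-distribʳ h (scale a g) (0# ∷ f ⊗ g) ⟩
      scale a g ⊗ h ⊕ (0# ∷ f ⊗ g) ⊗ h
        ≈⟨ ⊕-cong (⊗-scale a g h) (≋-trans (0∷-⊗ (f ⊗ g) h) (∷-cong refl (⊗-assoc f g h))) ⟩
      (a ∷ f) ⊗ (g ⊗ h) ∎
      where open ≋-Reasoning

    ⊗-[] : ∀ f → f ⊗ [] ≋ []
    ⊗-[] []      = ≋-refl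
    ⊗-[] (a ∷ f) = ≋-trans (∷-cong refl (⊗-[] f)) 0∷[]

    ⊗-∷ : ∀ f b g → f ⊗ (b ∷ g) ≋ scale b f ⊕ (0# ∷ f ⊗ g)
    ⊗-∷ []      b g = ≋-sym 0∷[]
    ⊗-∷ (a ∷ f) b g = ∷-cong (+-congʳ (*-comm a b)) (begin
      scale a g ⊕ f ⊗ (b ∷ g)                     ≈⟨ ⊕-cong (≋-refl {scale a g}) (⊗-∷ f b g) ⟩
      scale a g ⊕ (scale b f ⊕ (0# ∷ f ⊗ g))      ≈⟨ x∙yz≈y∙xz (scale a g) (scale b f) (0# ∷ f ⊗ g) ⟩
      scale b f ⊕ (a ∷ f) ⊗ g                     ∎)
      where open ≋-Reasoning

    ⊗-comm : ∀ f g → f ⊗ g ≋ g ⊗ f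
    ⊗-comm []      g = ≋-sym (⊗-[] g)
    ⊗-comm (a ∷ f) g = ≋-trans
      (⊕-cong (≋-refl {scale a g}) (∷-cong refl (⊗-comm f g))) (≋-sym (⊗-∷ g a f))

    ⊗-identityˡ : ∀ f → C 1# ⊗ f ≋ f
    ⊗-identityˡ f = ≋-trans (⊕-cong (scale-one f) 0∷[]) (⊕-identityʳ f)

  polynomialRing : CommutativeRing c ℓ
  polynomialRing = record
    { Carrier = Poly
    ; _≈_ = _≋_
    ; _+_ = _⊕_
    ; _*_ = _⊗_
    ; -_ = ⊖_
    ; 0# = []
    ; 1# = C 1#
    ; isCommutativeRing = record
      { isRing = record
        { +-isAbelianGroup = AbelianGroup.isAbelianGroup ⊕-abelianGroup
        ; *-cong = ⊗-cong
        ; *-assoc = ⊗-assoc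
        ; *-identity = ⊗-identityˡ , λ f → ≋-trans (⊗-comm f (C 1#)) (⊗-identityˡ f)
        ; distrib = (λ h f g → ≋-trans (⊗-comm h (f ⊕ g)) (≋-trans (⊗-distribʳ h f g)
                      (⊕-cong (⊗-comm f h) (⊗-comm g h))))
                  , ⊗-distribʳ
        }
      ; *-comm = ⊗-comm
      }
    }

-- p and q are arbitrary elements of an arbitrary commutative ring; taking
-- them to be the generators of ℤ[p,q] gives the identities between
-- polynomials in the indeterminates p and q.

module FibonacciStirling {c ℓ} (R : CommutativeRing c ℓ)
                         (p q : CommutativeRing.Carrier R) where

  open CommutativeRing R
  open Exp semiring using (_^_) public
  open Sum semiring using (sum) public
  open MonoidSum *-commutativeMonoid using () renaming (sum to product) public

  open Polynomial R

  module R[x] where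
    open CommutativeRing polynomialRing public
    open Exp (CommutativeRing.semiring polynomialRing) using (_^_) public
    open Sum (CommutativeRing.semiring polynomialRing) using (sum) public

  -- The sequence proper starts at F 1; F 0 = 0 extends its recurrence to m = 2.
  F : ℕ → Carrier
  F 0                   = 0#
  F 1                   = q
  F 2                   = q ^ 2
  F (suc (suc (suc m))) = q * F (suc (suc m)) + p * F (suc m)

  falling : ℕ → Poly
  falling 0             = R[x].1#
  falling 1             = X
  falling (suc (suc k)) = falling (suc k) R[x].* (X R[x].- C (F (suc k)))

  rising : ℕ → Poly
  rising 0             = R[x].1#
  rising 1             = X
  rising (suc (suc k)) = rising (suc k) R[x].* (X R[x].+ C (F (suc k)))

  -- The entries of S outside the triangle 0 ≤ k ≤ n are unconstrained.
  IsSf : (ℕ → ℕ → Carrier) → Set ℓ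
  IsSf S = ∀ n → X R[x].^ n R[x].≈
    R[x].sum {suc n} (λ k → C (S n (toℕ k)) R[x].* falling (toℕ k))

  Iscf : (ℕ → ℕ → Carrier) → Set ℓ
  Iscf s = ∀ n → rising n R[x].≈
    R[x].sum {suc n} (λ k → C (s n (toℕ k)) R[x].* X R[x].^ toℕ k)

  [_] : ℕ → Carrier
  [ m ] = sum {m} (λ i → q ^ toℕ i)

  -- Both defining systems of equations are solvable, so a theorem about all
  -- solutions is not vacuous.

  private
    shift : (a s : ℕ → Carrier) → ℕ → Carrier
    shift a s zero    = a 0 * s 0
    shift a s (suc k) = s k + a (suc k) * s (suc k)

    unit : ℕ → Carrier
    unit zero    = 1#
    unit (suc _) = 0#

    Vanishes : ℕ → (ℕ → Carrier) → Set ℓ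
    Vanishes n s = ∀ k → n < k → s k ≈ 0#

    x+y*0 : ∀ {x y z} → x ≈ 0# → z ≈ 0# → x + y * z ≈ 0#
    x+y*0 e e′ = trans (+-cong e (trans (*-congˡ e′) (zeroʳ _))) (+-identityˡ 0#)

    shift-vanishes : ∀ n a s → Vanishes n s → Vanishes (suc n) (shift a s)
    shift-vanishes n a s v (suc k) (s≤s n<k) = x+y*0 (v k n<k) (v (suc k) (m<n⇒m<1+n n<k))

    unit-vanishes : Vanishes 0 unit
    unit-vanishes (suc _) _ = refl

    C-cong : ∀ {a b} → a ≈ b → C a R[x].≈ C b
    C-cong e = mk λ { zero → e ; (suc _) → refl }

    C-0 : C 0# R[x].≈ R[x].0#
    C-0 = mk λ { zero → refl ; (suc _) → refl }

    C-* : ∀ a b → C (a * b) R[x].≈ C a R[x].* C b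
    C-* a b = mk λ { zero → sym (+-identityʳ _) ; (suc _) → refl }

    expand : (ℕ → Carrier) → (ℕ → Poly) → ℕ → Poly
    expand s b n = R[x].sum {n} (λ k → C (s (toℕ k)) R[x].* b (toℕ k))

    expand-extend : ∀ n s b → s n ≈ 0# → expand s b (suc n) R[x].≈ expand s b n
    expand-extend n s b e = begin
      expand s b (suc n)
        ≈⟨ Sum.sum-init-last R[x].semiring {n} (λ k → t (toℕ k)) ⟩
      R[x].sum {n} (λ k → t (toℕ (inject₁ k))) R[x].+ t (toℕ (fromℕ n))
        ≈⟨ R[x].+-cong (Sum.sum-cong-≋ R[x].semiring {n} λ k → R[x].reflexive (≡.cong t (toℕ-inject₁ k)))
                       (R[x].reflexive (≡.cong t (toℕ-fromℕ n))) ⟩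
      expand s b n R[x].+ t n
        ≈⟨ R[x].+-congˡ {expand s b n} (R[x].trans (R[x].*-congʳ (R[x].trans (C-cong e) C-0)) (R[x].zeroˡ (b n))) ⟩
      expand s b n R[x].+ R[x].0#
        ≈⟨ R[x].+-identityʳ _ ⟩
      expand s b n ∎
      where
      open SetoidReasoning R[x].setoid
      t : ℕ → Poly
      t k = C (s k) R[x].* b k

    expand-shift : ∀ n a s b Y → (∀ k → Y R[x].* b k R[x].≈ b (suc k) R[x].+ C (a k) R[x].* b k) →
                   Vanishes n s →
                   Y R[x].* expand s b (suc n) R[x].≈ expand (shift a s) b (suc (suc n))
    expand-shift n a s b Y step v = begin
      Y R[x].* expand s b (suc n)
        ≈⟨ Sum.*-distribˡ-sum R[x].semiring {suc n} Y (λ k → C (s (toℕ k)) R[x].* b (toℕ k)) ⟩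
      R[x].sum {suc n} (λ k → Y R[x].* (C (s (toℕ k)) R[x].* b (toℕ k)))
        ≈⟨ Sum.sum-cong-≋ R[x].semiring {suc n} (λ k → term (toℕ k)) ⟩
      R[x].sum {suc n} (λ k → up (toℕ k) R[x].+ stay (toℕ k))
        ≈⟨ Sum.∑-distrib-+ R[x].semiring {suc n} (λ k → up (toℕ k)) (λ k → stay (toℕ k)) ⟩
      R[x].sum {suc n} (λ k → up (toℕ k)) R[x].+ expand as b (suc n)
        ≈⟨ R[x].+-congˡ {R[x].sum {suc n} (λ k → up (toℕ k))}
             (expand-extend (suc n) as b (trans (*-congˡ (v (suc n) ≤-refl)) (zeroʳ _))) ⟨
      R[x].sum {suc n} (λ k → up (toℕ k)) R[x].+ expand as b (suc (suc n))
        ≈⟨ x∙yz≈y∙xz (R[x].sum {suc n} (λ k → up (toℕ k))) (stay 0)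
             (R[x].sum {suc n} (λ k → stay (suc (toℕ k)))) ⟩
      stay 0 R[x].+ (R[x].sum {suc n} (λ k → up (toℕ k)) R[x].+ R[x].sum {suc n} (λ k → stay (suc (toℕ k))))
        ≈⟨ R[x].+-congˡ {stay 0} (Sum.∑-distrib-+ R[x].semiring {suc n}
             (λ k → up (toℕ k)) (λ k → stay (suc (toℕ k)))) ⟨
      stay 0 R[x].+ R[x].sum {suc n} (λ k → up (toℕ k) R[x].+ stay (suc (toℕ k)))
        ≈⟨ R[x].+-congˡ {stay 0} (Sum.sum-cong-≋ R[x].semiring {suc n} λ k →
             R[x].distribʳ (b (suc (toℕ k))) (C (s (toℕ k))) (C (as (suc (toℕ k))))) ⟨
      expand (shift a s) b (suc (suc n)) ∎
      where
      open SetoidReasoning R[x].setoid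
      open CommutativeSemigroupProperties R[x].+-commutativeSemigroup using (x∙yz≈y∙xz)
      open CommutativeSemigroupProperties R[x].*-commutativeSemigroup using ()
        renaming (x∙yz≈y∙xz to x*yz≈y*xz; x∙yz≈yx∙z to x*yz≈yx*z)
      as : ℕ → Carrier
      as k = a k * s k
      up stay : ℕ → Poly
      up k   = C (s k) R[x].* b (suc k)
      stay k = C (as k) R[x].* b k
      term : ∀ k → Y R[x].* (C (s k) R[x].* b k) R[x].≈ up k R[x].+ stay k
      term k = begin
        Y R[x].* (C (s k) R[x].* b k)                       ≈⟨ x*yz≈y*xz Y (C (s k)) (b k) ⟩
        C (s k) R[x].* (Y R[x].* b k)                       ≈⟨ R[x].*-congˡ {C (s k)} (step k) ⟩
        C (s k) R[x].* (b (suc k) R[x].+ C (a k) R[x].* b k) ≈⟨ R[x].distribˡ (C (s k)) (b (suc k)) (C (a k) R[x].* b k) ⟩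
        up k R[x].+ C (s k) R[x].* (C (a k) R[x].* b k)      ≈⟨ R[x].+-congˡ {up k} (x*yz≈yx*z (C (s k)) (C (a k)) (b k)) ⟩
        up k R[x].+ C (a k) R[x].* C (s k) R[x].* b k        ≈⟨ R[x].+-congˡ {up k} (R[x].*-congʳ {b k} (C-* (a k) (s k))) ⟨
        up k R[x].+ stay k                                  ∎

    expand-unit : ∀ b → b 0 R[x].≈ R[x].1# → R[x].1# R[x].≈ expand unit b 1
    expand-unit b e = R[x].sym (R[x].trans (R[x].+-identityʳ _) (R[x].trans (R[x].*-identityˡ (b 0)) e))

    falling-step : ∀ k → X R[x].* falling k R[x].≈ falling (suc k) R[x].+ C (F k) R[x].* falling k
    falling-step zero = begin
      X R[x].* R[x].1#                     ≈⟨ R[x].*-identityʳ X ⟩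
      X                                    ≈⟨ R[x].+-identityʳ X ⟨
      X R[x].+ R[x].0#                     ≈⟨ R[x].+-congˡ {X} (R[x].trans (R[x].*-congʳ {R[x].1#} C-0) (R[x].zeroˡ R[x].1#)) ⟨
      X R[x].+ C 0# R[x].* R[x].1#         ∎
      where open SetoidReasoning R[x].setoid
    falling-step (suc k) = begin
      X R[x].* f                                       ≈⟨ R[x].*-comm X f ⟩
      f R[x].* X                                       ≈⟨ R[x].*-congˡ {f} cancel ⟨
      f R[x].* (X R[x].- d R[x].+ d)                   ≈⟨ R[x].distribˡ f (X R[x].- d) d ⟩
      f R[x].* (X R[x].- d) R[x].+ f R[x].* d          ≈⟨ R[x].+-congˡ {f R[x].* (X R[x].- d)} (R[x].*-comm f d) ⟩
      f R[x].* (X R[x].- d) R[x].+ d R[x].* f          ∎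
      where
      open SetoidReasoning R[x].setoid
      f d : Poly
      f = falling (suc k)
      d = C (F (suc k))
      cancel : X R[x].- d R[x].+ d R[x].≈ X
      cancel = R[x].trans (R[x].+-assoc X (R[x].- d) d)
        (R[x].trans (R[x].+-congˡ {X} (R[x].-‿inverseˡ d)) (R[x].+-identityʳ X))

    rising-step : ∀ n → rising (suc n) R[x].≈ (X R[x].+ C (F n)) R[x].* rising n
    rising-step zero    = R[x].sym (R[x].trans (R[x].*-identityʳ (X R[x].+ C 0#))
      (R[x].trans (R[x].+-congˡ {X} C-0) (R[x].+-identityʳ X)))
    rising-step (suc n) = R[x].*-comm (rising (suc n)) (X R[x].+ C (F (suc n)))

    S₀ s₀ : ℕ → ℕ → Carrier
    S₀ zero    = unit
    S₀ (suc n) = shift F (S₀ n)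
    s₀ zero    = unit
    s₀ (suc n) = shift (λ _ → F n) (s₀ n)

    S₀-vanishes : ∀ n → Vanishes n (S₀ n)
    S₀-vanishes zero    = unit-vanishes
    S₀-vanishes (suc n) = shift-vanishes n F (S₀ n) (S₀-vanishes n)

    s₀-vanishes : ∀ n → Vanishes n (s₀ n)
    s₀-vanishes zero    = unit-vanishes
    s₀-vanishes (suc n) = shift-vanishes n (λ _ → F n) (s₀ n) (s₀-vanishes n)

  Sf-exists : ∃ IsSf
  Sf-exists = S₀ , isSf
    where
    isSf : IsSf S₀
    isSf zero    = expand-unit falling R[x].refl
    isSf (suc n) = R[x].trans (R[x].*-congˡ {X} (isSf n))
      (expand-shift n F (S₀ n) falling X falling-step (S₀-vanishes n))

  cf-exists : ∃ Iscf
  cf-exists = s₀ , iscf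
    where
    iscf : Iscf s₀
    iscf zero    = expand-unit (X R[x].^_) R[x].refl
    iscf (suc n) = R[x].trans (rising-step n)
      (R[x].trans (R[x].*-congˡ {X R[x].+ C (F n)} (iscf n))
        (expand-shift n (λ _ → F n) (s₀ n) (X R[x].^_) (X R[x].+ C (F n))
          (λ k → R[x].distribʳ (X R[x].^ k) X (C (F n))) (s₀-vanishes n)))

-- The coefficients of a polynomial in a family of monic polynomials of degrees
-- 0, 1, 2, … are unique, so Sf and cf agree for k ≤ n with the solutions
-- constructed in Sf-exists and cf-exists, which satisfy by computation the
-- recurrence T (n+1) (k+1) = T n k + a n k T n (k+1), where a n k is
-- F (k+1) for Sf and F n for cf.  All the formulas follow by induction on n;
-- the two subdiagonals agree because a (n+1) n = F (n+1) in both cases.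

module Submission where

open import Defs
open import Algebra.Bundles using (CommutativeMonoid; CommutativeRing)
open import Data.Fin.Base using (toℕ)
open import Data.Fin.Properties using (toℕ-inject₁; toℕ-fromℕ)
open import Data.List.Base using ([]; _∷_)
open import Data.Nat.Base using (ℕ; zero; suc; _∸_; _≤_; _<_; _≥_; z≤n; s≤s)
open import Data.Nat.Properties using (≤-refl; ≤-trans; n<1+n; n≤1+n; m<n⇒m<1+n; m<1+n⇒m<n∨m≡n)
open import Data.Product.Base using (_×_; _,_; proj₁; proj₂)
open import Data.Sum.Base using (inj₁; inj₂)
import Relation.Binary.PropositionalEquality.Core as ≡

import Algebra.Properties.AbelianGroup as AbelianGroupProperties
import Algebra.Properties.CommutativeMonoid.Sum as MonoidSum
import Algebra.Properties.CommutativeSemigroup as CommutativeSemigroupProperties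
import Algebra.Properties.Semiring.Sum as Sum
import Relation.Binary.Reasoning.Setoid as SetoidReasoning

-- Splitting off the last term of a finite sum or product.

module _ {c ℓ} (M : CommutativeMonoid c ℓ) where

  open CommutativeMonoid M
  open MonoidSum M using (sum; sum-init-last; sum-cong-≋)

  -- `sum` unfolds at its first index, whereas the inductions below add the largest one. A general
  -- monoid covers sums of polynomials as well as sums and products in the ring.
  sum-toℕ-last : ∀ n (g : ℕ → Carrier) →
    sum {suc n} (λ i → g (toℕ i)) ≈ sum {n} (λ i → g (toℕ i)) ∙ g n
  sum-toℕ-last n g = trans (sum-init-last {n} (λ i → g (toℕ i)))
    (∙-cong (sum-cong-≋ {n} (λ i → reflexive (≡.cong g (toℕ-inject₁ i))))
            (reflexive (≡.cong g (toℕ-fromℕ n))))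

-- Uniqueness of expansions in monic polynomials of degrees 0, 1, 2, ...

module MonicExpansion {c ℓ} (R : CommutativeRing c ℓ) where

  open CommutativeRing R
  open Polynomial R
  open SetoidReasoning setoid

  module P where
    open CommutativeRing polynomialRing public
    open Sum (CommutativeRing.semiring polynomialRing) using (sum) public

  coeff-⊕ : ∀ f g i → coeff (f ⊕ g) i ≈ coeff f i + coeff g i
  coeff-⊕ []      g       i       = sym (+-identityˡ _)
  coeff-⊕ (a ∷ f) []      i       = sym (+-identityʳ _)
  coeff-⊕ (a ∷ f) (b ∷ g) zero    = refl
  coeff-⊕ (a ∷ f) (b ∷ g) (suc i) = coeff-⊕ f g i

  coeff-scale : ∀ a f i → coeff (scale a f) i ≈ a * coeff f i
  coeff-scale a []      i       = sym (zeroʳ a)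
  coeff-scale a (b ∷ f) zero    = refl
  coeff-scale a (b ∷ f) (suc i) = coeff-scale a f i

  coeff-C⊗ : ∀ a f i → coeff (C a ⊗ f) i ≈ a * coeff f i
  coeff-C⊗ a f i = begin
    coeff (scale a f ⊕ (0# ∷ [])) i             ≈⟨ coeff-⊕ (scale a f) (0# ∷ []) i ⟩
    coeff (scale a f) i + coeff (0# ∷ []) i     ≈⟨ +-cong (coeff-scale a f i) (coeff-0∷[] i) ⟩
    a * coeff f i + 0#                          ≈⟨ +-identityʳ _ ⟩
    a * coeff f i                               ∎
    where
    coeff-0∷[] : ∀ i → coeff (0# ∷ []) i ≈ 0#
    coeff-0∷[] zero    = refl
    coeff-0∷[] (suc i) = refl

  -- The list `a ∷ C 1#` is the linear polynomial x + a.
  coeff-linear⊗ : ∀ a f i → coeff ((a ∷ C 1#) ⊗ f) (suc i) ≈ a * coeff f (suc i) + coeff f i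
  coeff-linear⊗ a f i = begin
    coeff (scale a f ⊕ (0# ∷ C 1# ⊗ f)) (suc i)     ≈⟨ coeff-⊕ (scale a f) (0# ∷ C 1# ⊗ f) (suc i) ⟩
    coeff (scale a f) (suc i) + coeff (C 1# ⊗ f) i  ≈⟨ +-cong (coeff-scale a f (suc i)) (coeff-≈ (P.*-identityˡ f) i) ⟩
    a * coeff f (suc i) + coeff f i                 ∎

  -- Phrased through coefficients because trailing zeros make the length of the list meaningless as
  -- a degree.
  MonicOfDegree : ℕ → Poly → Set ℓ
  MonicOfDegree n f = coeff f n ≈ 1# × (∀ i → n < i → coeff f i ≈ 0#)

  monic-resp-≋ : ∀ {n f g} → f ≋ g → MonicOfDegree n f → MonicOfDegree n g
  monic-resp-≋ f≋g (lead , above) =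
    trans (sym (coeff-≈ f≋g _)) lead , λ i n<i → trans (sym (coeff-≈ f≋g i)) (above i n<i)

  monic-1 : MonicOfDegree 0 (C 1#)
  monic-1 = refl , λ { (suc i) _ → refl }

  monic-linear⊗ : ∀ a f {n} → MonicOfDegree n f → MonicOfDegree (suc n) ((a ∷ C 1#) ⊗ f)
  monic-linear⊗ a f {n} (lead , above) = lead′ , above′
    where
    lead′ : coeff ((a ∷ C 1#) ⊗ f) (suc n) ≈ 1#
    lead′ = begin
      coeff ((a ∷ C 1#) ⊗ f) (suc n)     ≈⟨ coeff-linear⊗ a f n ⟩
      a * coeff f (suc n) + coeff f n    ≈⟨ +-cong (*-congˡ (above (suc n) (n<1+n n))) lead ⟩
      a * 0# + 1#                        ≈⟨ +-congʳ (zeroʳ a) ⟩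
      0# + 1#                            ≈⟨ +-identityˡ 1# ⟩
      1#                                 ∎
    above′ : ∀ i → suc n < i → coeff ((a ∷ C 1#) ⊗ f) i ≈ 0#
    above′ (suc i) (s≤s n<i) = begin
      coeff ((a ∷ C 1#) ⊗ f) (suc i)     ≈⟨ coeff-linear⊗ a f i ⟩
      a * coeff f (suc i) + coeff f i    ≈⟨ +-cong (*-congˡ (above (suc i) (m<n⇒m<1+n n<i))) (above i n<i) ⟩
      a * 0# + 0#                        ≈⟨ +-identityʳ _ ⟩
      a * 0#                             ≈⟨ zeroʳ a ⟩
      0#                                 ∎

  module _ (b : ℕ → Poly) (monic : ∀ k → MonicOfDegree k (b k)) where

    expand : (ℕ → Carrier) → ℕ → Poly
    expand s n = P.sum {n} (λ k → C (s (toℕ k)) ⊗ b (toℕ k))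

    expand-suc : ∀ s n → expand s (suc n) ≋ expand s n ⊕ C (s n) ⊗ b n
    expand-suc s n = sum-toℕ-last P.+-commutativeMonoid n (λ k → C (s k) ⊗ b k)

    coeff-expand-suc : ∀ s n i → coeff (expand s (suc n)) i ≈ coeff (expand s n) i + s n * coeff (b n) i
    coeff-expand-suc s n i = begin
      coeff (expand s (suc n)) i                       ≈⟨ coeff-≈ (expand-suc s n) i ⟩
      coeff (expand s n ⊕ C (s n) ⊗ b n) i             ≈⟨ coeff-⊕ (expand s n) (C (s n) ⊗ b n) i ⟩
      coeff (expand s n) i + coeff (C (s n) ⊗ b n) i   ≈⟨ +-congˡ (coeff-C⊗ (s n) (b n) i) ⟩
      coeff (expand s n) i + s n * coeff (b n) i       ∎

    coeff-expand-above : ∀ s n i → n ≤ i → coeff (expand s n) i ≈ 0#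
    coeff-expand-above s zero    i _   = refl
    coeff-expand-above s (suc n) i n<i = begin
      coeff (expand s (suc n)) i                   ≈⟨ coeff-expand-suc s n i ⟩
      coeff (expand s n) i + s n * coeff (b n) i   ≈⟨ +-cong (coeff-expand-above s n i (≤-trans (n≤1+n n) n<i))
                                                             (*-congˡ (proj₂ (monic n) i n<i)) ⟩
      0# + s n * 0#                                ≈⟨ +-identityˡ _ ⟩
      s n * 0#                                     ≈⟨ zeroʳ _ ⟩
      0#                                           ∎

    coeff-expand-lead : ∀ s n → coeff (expand s (suc n)) n ≈ s n
    coeff-expand-lead s n = begin
      coeff (expand s (suc n)) n                   ≈⟨ coeff-expand-suc s n n ⟩
      coeff (expand s n) n + s n * coeff (b n) n   ≈⟨ +-cong (coeff-expand-above s n n ≤-refl)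
                                                             (*-congˡ (proj₁ (monic n))) ⟩
      0# + s n * 1#                                ≈⟨ +-identityˡ _ ⟩
      s n * 1#                                     ≈⟨ *-identityʳ _ ⟩
      s n                                          ∎

    expand-lead-injective : ∀ s t n → expand s (suc n) ≋ expand t (suc n) → s n ≈ t n
    expand-lead-injective s t n e = begin
      s n                          ≈⟨ coeff-expand-lead s n ⟨
      coeff (expand s (suc n)) n   ≈⟨ coeff-≈ e n ⟩
      coeff (expand t (suc n)) n   ≈⟨ coeff-expand-lead t n ⟩
      t n                          ∎

    -- Since `s n` and `t n` agree, the last terms coincide and cancel in every degree.
    expand-init-injective : ∀ s t n → expand s (suc n) ≋ expand t (suc n) → expand s n ≋ expand t n
    expand-init-injective s t n e = mk λ i → +-cancelʳ (s n * coeff (b n) i) _ _ (begin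
      coeff (expand s n) i + s n * coeff (b n) i   ≈⟨ coeff-expand-suc s n i ⟨
      coeff (expand s (suc n)) i                   ≈⟨ coeff-≈ e i ⟩
      coeff (expand t (suc n)) i                   ≈⟨ coeff-expand-suc t n i ⟩
      coeff (expand t n) i + t n * coeff (b n) i   ≈⟨ +-congˡ (*-congʳ (expand-lead-injective s t n e)) ⟨
      coeff (expand t n) i + s n * coeff (b n) i   ∎)
      where open AbelianGroupProperties +-abelianGroup renaming (∙-cancelʳ to +-cancelʳ)

    -- Elimination from the top degree downwards.
    expand-injective : ∀ s t n → expand s n ≋ expand t n → ∀ k → k < n → s k ≈ t k
    expand-injective s t (suc n) e k k<1+n with m<1+n⇒m<n∨m≡n k<1+n
    ... | inj₁ k<n    = expand-injective s t n (expand-init-injective s t n e) k k<n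
    ... | inj₂ ≡.refl = expand-lead-injective s t n e

-- Diagonal and subdiagonal of an array with a triangular recurrence.

module TriangularArray {c ℓ} (R : CommutativeRing c ℓ) where

  open CommutativeRing R
  open SetoidReasoning setoid

  module _ (T a : ℕ → ℕ → Carrier)
           (T-0-0 : T 0 0 ≈ 1#) (T-0-suc : ∀ k → T 0 (suc k) ≈ 0#)
           (step : ∀ n k → T (suc n) (suc k) ≈ T n k + a n k * T n (suc k)) where

    step-above : ∀ n k → T n (suc k) ≈ 0# → T (suc n) (suc k) ≈ T n k
    step-above n k e = begin
      T (suc n) (suc k)               ≈⟨ step n k ⟩
      T n k + a n k * T n (suc k)     ≈⟨ +-congˡ (*-congˡ e) ⟩
      T n k + a n k * 0#              ≈⟨ +-congˡ (zeroʳ _) ⟩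
      T n k + 0#                      ≈⟨ +-identityʳ _ ⟩
      T n k                           ∎

    above-diagonal : ∀ n k → n < k → T n k ≈ 0#
    above-diagonal zero    (suc k) _         = T-0-suc k
    above-diagonal (suc n) (suc k) (s≤s n<k) =
      trans (step-above n k (above-diagonal n (suc k) (m<n⇒m<1+n n<k))) (above-diagonal n k n<k)

    diagonal : ∀ n → T n n ≈ 1#
    diagonal zero    = T-0-0
    diagonal (suc n) = trans (step-above n n (above-diagonal n (suc n) (n<1+n n))) (diagonal n)

    -- The weight multiplies a diagonal entry, which is 1.
    subdiagonal-suc : ∀ n → T (suc (suc n)) (suc n) ≈ T (suc n) n + a (suc n) n
    subdiagonal-suc n = begin
      T (suc (suc n)) (suc n)                       ≈⟨ step (suc n) n ⟩
      T (suc n) n + a (suc n) n * T (suc n) (suc n) ≈⟨ +-congˡ (*-congˡ (diagonal (suc n))) ⟩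
      T (suc n) n + a (suc n) n * 1#                ≈⟨ +-congˡ (*-identityʳ _) ⟩
      T (suc n) n + a (suc n) n                     ∎

    open Sum semiring using (sum)

    -- Only the weights `a (suc n) n` enter, so arrays whose weights agree there share their
    -- subdiagonal.
    subdiagonal : (f : ℕ → Carrier) → (∀ n → a (suc n) n ≈ f (suc n)) → T 1 0 ≈ 0# →
      ∀ n → T (suc n) n ≈ sum {n} (λ i → f (suc (toℕ i)))
    subdiagonal f a≈f T-1-0 zero    = T-1-0
    subdiagonal f a≈f T-1-0 (suc n) = begin
      T (suc (suc n)) (suc n)                        ≈⟨ subdiagonal-suc n ⟩
      T (suc n) n + a (suc n) n                      ≈⟨ +-cong (subdiagonal f a≈f T-1-0 n) (a≈f n) ⟩
      sum {n} (λ i → f (suc (toℕ i))) + f (suc n)    ≈⟨ sum-toℕ-last +-commutativeMonoid n (λ k → f (suc k)) ⟨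
      sum {suc n} (λ i → f (suc (toℕ i)))            ∎

-- The two Fibonacci-Stirling arrays and their columns.

module FibonacciStirlingNumbers {c ℓ} (R : CommutativeRing c ℓ)
                                (p q : CommutativeRing.Carrier R) where

  open CommutativeRing R
  open FibonacciStirling R p q
  open Polynomial R
  open MonicExpansion R
  open SetoidReasoning setoid

  falling-monic : ∀ k → MonicOfDegree k (falling k)
  falling-monic zero          = monic-1
  falling-monic (suc zero)    = refl , λ { (suc (suc i)) _ → refl ; (suc zero) (s≤s ()) }
  -- The factor `X R[x].- C (F (suc k))` computes to `(0# - F (suc k)) ∷ C 1#`; commutativity moves
  -- it to the left.
  falling-monic (suc (suc k)) = monic-resp-≋ (R[x].*-comm (X R[x].- C (F (suc k))) (falling (suc k)))
    (monic-linear⊗ (0# - F (suc k)) (falling (suc k)) (falling-monic (suc k)))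

  power-monic : ∀ k → MonicOfDegree k (X R[x].^ k)
  power-monic zero    = monic-1
  power-monic (suc k) = monic-linear⊗ 0# (X R[x].^ k) (power-monic k)

  Sf-unique : ∀ S T → IsSf S → IsSf T → ∀ n k → k ≤ n → S n k ≈ T n k
  Sf-unique S T isS isT n k k≤n = expand-injective falling falling-monic (S n) (T n) (suc n)
    (mk λ i → trans (sym (coeff-≈ (isS n) i)) (coeff-≈ (isT n) i)) k (s≤s k≤n)

  cf-unique : ∀ s t → Iscf s → Iscf t → ∀ n k → k ≤ n → s n k ≈ t n k
  cf-unique s t iss ist n k k≤n = expand-injective (X R[x].^_) power-monic (s n) (t n) (suc n)
    (mk λ i → trans (sym (coeff-≈ (iss n) i)) (coeff-≈ (ist n) i)) k (s≤s k≤n)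

  Sf₀ cf₀ : ℕ → ℕ → Carrier
  Sf₀ = proj₁ Sf-exists
  cf₀ = proj₁ cf-exists

  open TriangularArray R

  Sf₀-step : ∀ n k → Sf₀ (suc n) (suc k) ≈ Sf₀ n k + F (suc k) * Sf₀ n (suc k)
  Sf₀-step n k = refl

  cf₀-step : ∀ n k → cf₀ (suc n) (suc k) ≈ cf₀ n k + F n * cf₀ n (suc k)
  cf₀-step n k = refl

  -- In column 0 each new entry is `F 0`, that is `0#`, times the entry above it.
  Sf₀-column-0 : ∀ n → Sf₀ (suc n) 0 ≈ 0#
  Sf₀-column-0 n = zeroˡ _

  -- Here the weight depends on the row: the factor `F 0` enters only in row 1, and the zero then
  -- propagates downwards.
  cf₀-column-0 : ∀ n → cf₀ (suc n) 0 ≈ 0#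
  cf₀-column-0 zero    = zeroˡ _
  cf₀-column-0 (suc n) = trans (*-congˡ (cf₀-column-0 n)) (zeroʳ _)

  Sf₀-diagonal : ∀ n → Sf₀ n n ≈ 1#
  Sf₀-diagonal = diagonal Sf₀ (λ _ k → F (suc k)) refl (λ _ → refl) Sf₀-step

  cf₀-diagonal : ∀ n → cf₀ n n ≈ 1#
  cf₀-diagonal = diagonal cf₀ (λ n _ → F n) refl (λ _ → refl) cf₀-step

  Sf₀-subdiagonal : ∀ n → Sf₀ (suc n) n ≈ sum {n} (λ i → F (suc (toℕ i)))
  Sf₀-subdiagonal = subdiagonal Sf₀ (λ _ k → F (suc k)) refl (λ _ → refl) Sf₀-step
    F (λ _ → refl) (Sf₀-column-0 0)

  cf₀-subdiagonal : ∀ n → cf₀ (suc n) n ≈ sum {n} (λ i → F (suc (toℕ i)))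
  cf₀-subdiagonal = subdiagonal cf₀ (λ n _ → F n) refl (λ _ → refl) cf₀-step
    F (λ _ → refl) (cf₀-column-0 0)

  Sf₀-column-1 : ∀ n → Sf₀ (suc n) 1 ≈ q ^ n
  Sf₀-column-1 zero    = Sf₀-diagonal 1
  Sf₀-column-1 (suc n) = begin
    Sf₀ (suc n) 0 + q * Sf₀ (suc n) 1     ≈⟨ +-cong (Sf₀-column-0 n) (*-congˡ (Sf₀-column-1 n)) ⟩
    0# + q * q ^ n                        ≈⟨ +-identityˡ _ ⟩
    q ^ suc n                             ∎

  cf₀-column-1 : ∀ n → cf₀ (suc n) 1 ≈ product {n} (λ i → F (suc (toℕ i)))
  cf₀-column-1 zero    = cf₀-diagonal 1
  cf₀-column-1 (suc n) = begin
    cf₀ (suc n) 0 + F (suc n) * cf₀ (suc n) 1               ≈⟨ +-cong (cf₀-column-0 n) (*-congˡ (cf₀-column-1 n)) ⟩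
    0# + F (suc n) * product {n} (λ i → F (suc (toℕ i)))    ≈⟨ +-identityˡ _ ⟩
    -- The recurrence puts the new factor in front, but it has the largest index and belongs at the
    -- end.
    F (suc n) * product {n} (λ i → F (suc (toℕ i)))         ≈⟨ *-comm _ _ ⟩
    product {n} (λ i → F (suc (toℕ i))) * F (suc n)         ≈⟨ sum-toℕ-last *-commutativeMonoid n (λ k → F (suc k)) ⟨
    product {suc n} (λ i → F (suc (toℕ i)))                 ∎

  -- The first term is 1, and each later one contains a factor `q`.
  [suc] : ∀ n → [ suc n ] ≈ 1# + q * [ n ]
  [suc] n = +-congˡ (sym (Sum.*-distribˡ-sum semiring {n} q (λ i → q ^ toℕ i)))

  Sf₀-column-2 : ∀ n → Sf₀ (suc (suc n)) 2 ≈ q ^ n * [ suc n ]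
  Sf₀-column-2 zero    = trans (Sf₀-diagonal 2) (sym (trans (*-identityˡ _) (+-identityʳ 1#)))
  Sf₀-column-2 (suc n) = begin
    Sf₀ (suc (suc n)) 1 + q ^ 2 * Sf₀ (suc (suc n)) 2     ≈⟨ +-cong (Sf₀-column-1 (suc n)) (*-congˡ (Sf₀-column-2 n)) ⟩
    q ^ suc n + q ^ 2 * (q ^ n * [ suc n ])               ≈⟨ +-congˡ (*-congʳ (*-congˡ (*-identityʳ q))) ⟩
    -- Of the two factors from `F 2`, one raises the power of `q` and the other multiplies the
    -- bracket, so that `q ^ suc n` can be factored out.
    q ^ suc n + q * q * (q ^ n * [ suc n ])               ≈⟨ +-congˡ (interchange q q (q ^ n) [ suc n ]) ⟩
    q ^ suc n + q ^ suc n * (q * [ suc n ])               ≈⟨ +-congʳ (*-identityʳ _) ⟨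
    q ^ suc n * 1# + q ^ suc n * (q * [ suc n ])          ≈⟨ distribˡ _ _ _ ⟨
    q ^ suc n * (1# + q * [ suc n ])                      ≈⟨ *-congˡ ([suc] (suc n)) ⟨
    q ^ suc n * [ suc (suc n) ]                           ∎
    where open CommutativeSemigroupProperties *-commutativeSemigroup using (interchange)

theorem9 :
  ∀ {c ℓ} (R : CommutativeRing c ℓ) (p q : CommutativeRing.Carrier R) →
  let open CommutativeRing R
      open FibonacciStirling R p q
  in
  (Sf cf : ℕ → ℕ → Carrier) → IsSf Sf → Iscf cf →
  (∀ n → n ≥ 1 →
    (Sf n 1 ≈ q ^ (n ∸ 1)) ×
    (cf n 1 ≈ product {n ∸ 1} (λ i → F (suc (toℕ i))))) ×
  (∀ n → n ≥ 2 →
    (Sf n 2 ≈ q ^ (n ∸ 2) * [ n ∸ 1 ]) ×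
    (cf n (n ∸ 1) ≈ Sf n (n ∸ 1)) ×
    (Sf n (n ∸ 1) ≈ sum {n ∸ 1} (λ i → F (suc (toℕ i)))))
theorem9 R p q Sf cf isSf iscf =
  -- Matching on successors lets the truncated subtractions compute, which turns the goals into the
  -- column lemmas with shifted index.
  (λ { (suc n) _ →
    trans (Sf≈ (suc n) 1 (s≤s z≤n)) (Sf₀-column-1 n) ,
    trans (cf≈ (suc n) 1 (s≤s z≤n)) (cf₀-column-1 n) }) ,
  (λ { (suc (suc n)) (s≤s (s≤s _)) →
    trans (Sf≈ (suc (suc n)) 2 (s≤s (s≤s z≤n))) (Sf₀-column-2 n) ,
    trans (cf-subdiagonal (suc n)) (sym (Sf-subdiagonal (suc n))) ,
    Sf-subdiagonal (suc n) })
  where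
  open CommutativeRing R
  open FibonacciStirling R p q
  open FibonacciStirlingNumbers R p q

  Sf≈ : ∀ n k → k ≤ n → Sf n k ≈ Sf₀ n k
  Sf≈ = Sf-unique Sf Sf₀ isSf (proj₂ Sf-exists)

  cf≈ : ∀ n k → k ≤ n → cf n k ≈ cf₀ n k
  cf≈ = cf-unique cf cf₀ iscf (proj₂ cf-exists)

  Sf-subdiagonal : ∀ n → Sf (suc n) n ≈ sum {n} (λ i → F (suc (toℕ i)))
  Sf-subdiagonal n = trans (Sf≈ (suc n) n (n≤1+n n)) (Sf₀-subdiagonal n)

  cf-subdiagonal : ∀ n → cf (suc n) n ≈ sum {n} (λ i → F (suc (toℕ i)))
  cf-subdiagonal n = trans (cf≈ (suc n) n (n≤1+n n)) (cf₀-subdiagonal n)
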